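{- Let $G$ be a decompleted capped X-ladder with $|V(G)|\ge 7$. That is, for an integer $m\ge 4$, let $\Gamma$ be the 4-regular graph with vertices $u_1,v_1,\dots,u_m,v_m$ whose edges are $u_iu_{i+1},\,u_iv_{i+1},\,v_iu_{i+1},\,v_iv_{i+1}$ for $1\le i\le m-1$, together with the four edges $u_1v_1,\ u_mv_m,\ u_1u_m,\ v_1v_m$, and let $G=\Gamma\setminus u_1$. Then $c_2^{(2)}(G)=0$.
   Context: $\Gamma\setminus u_1$ denotes the graph obtained by deleting the vertex $u_1$ and its incident edges. For a connected graph $G$, assign a variable $\alpha_e$ to each edge $e$. The Kirchhoff polynomial is $\Psi_G=\sum_T\prod_{e\notin T}\alpha_e$, the sum running over all spanning trees $T$ of $G$. For a prime $p$, $[\Psi_G]_p$ is the number of zeros of $\Psi_G$ in $\mathbb{F}_p^{|E(G)|}$. If $G$ has at least 3 vertices, then $[\Psi_G]_p$ is divisible by $p^2$, and the $c_2$ invariant of $G$ at $p$ is $c_2^{(p)}(G)=\frac{[\Psi_G]_p}{p^2}\bmod p$. -}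

module Defs where

open import Algebra.Bundles.Raw using (RawSemiring)
open import Data.Empty using (⊥-elim)
open import Data.Fin using (Fin; zero; suc; inject₁; fromℕ; combine; punchOut; toℕ; _≟_)
open import Data.Fin.Properties using (any?; all?)
open import Data.Fin.Subset using (Subset; inside; outside; _∈_; _-_; ⊤; ∣_∣)
open import Data.Fin.Subset.Properties using (_∈?_; x∈p⇒∣p-x∣<∣p∣)
open import Data.List
  using (List; []; _∷_; _++_; [_]; map; filter; foldr; length; lookup; allFin;
         concatMap; cartesianProductWith; mapMaybe)
open import Data.Maybe using (Maybe; just; nothing; zip)
open import Data.Nat using (ℕ; zero; suc; pred; _+_; _*_; _^_; _≤_; _<_; _/_; _%_; NonZero)
open import Data.Nat.DivMod using (_mod_)
open import Data.Nat.Properties using (≤-refl; ≤-trans; ≤-pred; m^n≢0)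
open import Data.Product using (∃; _×_; _,_)
open import Data.Product.Properties using (≡-dec)
open import Data.Sum using (_⊎_)
open import Data.Vec as Vec using (Vec; []; _∷_)
open import Level using (0ℓ)
open import Relation.Binary.PropositionalEquality using (_≡_; refl)
open import Relation.Nullary using (¬_; Dec; yes; no)
open import Relation.Nullary.Decidable using (¬?; _×-dec_; _⊎-dec_; map′)

-- A finite undirected (multi)graph on the vertices Fin n, given by its edges.
-- The order of the list, and of the two ends of an edge, carries no meaning;
-- the edge set of G is Fin (length G).
Graph : ℕ → Set
Graph n = List (Fin n × Fin n)

-- The vertices other than x are renumbered, in order, by punchOut.
_∖_ : ∀ {n} → Graph (suc n) → Fin (suc n) → Graph n
_∖_ {n} G x = mapMaybe (λ (a , b) → zip (rename a) (rename b)) G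
  where
  rename : Fin (suc n) → Maybe (Fin n)
  rename y with x ≟ y
  ... | yes _   = nothing
  ... | no  x≢y = just (punchOut x≢y)

module _ {n : ℕ} (G : Graph n) where

  EdgeSet : Set
  EdgeSet = Subset (length G)

  Joins : Fin (length G) → Fin n → Fin n → Set
  Joins e u w = lookup G e ≡ (u , w) ⊎ lookup G e ≡ (w , u)

  joins? : ∀ e u w → Dec (Joins e u w)
  joins? e u w = ≡-dec _≟_ _≟_ (lookup G e) (u , w) ⊎-dec ≡-dec _≟_ _≟_ (lookup G e) (w , u)

  -- Paths with all edges in T and all vertices in A.  Each vertex is removed
  -- from A once visited, so a path never repeats a vertex.
  data Path (T : EdgeSet) : Subset n → Fin n → Fin n → Set where
    stop : ∀ {A u} → u ∈ A → Path T A u u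
    step : ∀ {A u v} e w → u ∈ A → e ∈ T → Joins e u w →
           Path T (A - u) w v → Path T A u v

  Connected : EdgeSet → Set
  Connected T = ∀ u v → Path T ⊤ u v

  -- A cycle is a path together with a further edge joining its two ends.
  -- (A loop and a pair of parallel edges are cycles.)
  HasCycle : EdgeSet → Set
  HasCycle T = ∃ λ e → ∃ λ u → ∃ λ w → e ∈ T × Joins e u w × Path (T - e) ⊤ w u

  IsSpanningTree : EdgeSet → Set
  IsSpanningTree T = Connected T × ¬ HasCycle T

  private
    path?′ : ∀ b T A → ∣ A ∣ < b → ∀ u v → Dec (Path T A u v)
    path?′ (suc b) T A A<b u v with u ∈? A
    ... | no  u∉A = no λ { (stop u∈A) → u∉A u∈A ; (step _ _ u∈A _ _ _) → u∉A u∈A }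
    ... | yes u∈A with u ≟ v
    ...   | yes refl = yes (stop u∈A)
    ...   | no  u≢v  = map′
              (λ (e , w , e∈T , j , p) → step e w u∈A e∈T j p)
              (λ { (stop _)              → ⊥-elim (u≢v refl)
                 ; (step e w _ e∈T j p) → e , w , e∈T , j , p })
              (any? λ e → any? λ w → (e ∈? T) ×-dec joins? e u w ×-dec
                 path?′ b T (A - u) (≤-trans (x∈p⇒∣p-x∣<∣p∣ u∈A) (≤-pred A<b)) w v)

  path? : ∀ T A u v → Dec (Path T A u v)
  path? T A = path?′ (suc ∣ A ∣) T A ≤-refl

  isSpanningTree? : ∀ T → Dec (IsSpanningTree T)
  isSpanningTree? T =
    (all? λ u → all? λ v → path? T ⊤ u v) ×-dec
    ¬? (any? λ e → any? λ u → any? λ w →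
          (e ∈? T) ×-dec joins? e u w ×-dec path? (T - e) ⊤ w u)

-- All vectors of length k with entries from a list, in lexicographic order.
tuples : ∀ {A : Set} → List A → ∀ k → List (Vec A k)
tuples xs zero    = [ [] ]
tuples xs (suc k) = cartesianProductWith _∷_ xs (tuples xs k)

spanningTrees : ∀ {n} (G : Graph n) → List (EdgeSet G)
spanningTrees G = filter (isSpanningTree? G) (tuples (outside ∷ inside ∷ []) (length G))

-- The Kirchhoff polynomial, as the function α ↦ Ψ_G(α) on a coefficient (semi)ring.
module _ (R : RawSemiring 0ℓ 0ℓ) where
  open RawSemiring R using (Carrier; 0#; 1#) renaming (_+_ to _⊕_; _*_ to _⊗_)

  Ψ : ∀ {n} (G : Graph n) → Vec Carrier (length G) → Carrier
  Ψ G α = foldr _⊕_ 0# (map monomial (spanningTrees G))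
    where
    monomial : EdgeSet G → Carrier
    monomial T = foldr _⊗_ 1#
      (map (Vec.lookup α) (filter (λ e → ¬? (e ∈? T)) (allFin (length G))))

-- ℤ/pℤ, with the residues 0, …, p - 1 as elements.
𝔽 : (p : ℕ) → .{{NonZero p}} → RawSemiring 0ℓ 0ℓ
𝔽 p = record
  { Carrier = Fin p
  ; _≈_     = _≡_
  ; _+_     = λ a b → (toℕ a + toℕ b) mod p
  ; _*_     = λ a b → (toℕ a * toℕ b) mod p
  ; 0#      = 0 mod p
  ; 1#      = 1 mod p
  }

zeroCount : (p : ℕ) → .{{_ : NonZero p}} → ∀ {n} → Graph n → ℕ
zeroCount p G = length (filter (λ α → Ψ (𝔽 p) G α ≟ 0 mod p) (tuples (allFin p) (length G)))

-- The residue in {0, …, p - 1} of the c₂ invariant at the prime p.  For a connected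
-- graph with at least 3 vertices the division by p² is exact.
c₂ : (p : ℕ) → .{{_ : NonZero p}} → ∀ {n} → Graph n → ℕ
c₂ p G = ((zeroCount p G / p ^ 2) {{m^n≢0 p 2}}) % p

-- The capped X-ladder on 2m vertices, with m = suc k.  Indices are shifted by one:
-- u i and v i stand for u_{i+1} and v_{i+1}.
module CappedXLadder (k : ℕ) where

  u v : Fin (suc k) → Fin (suc k * 2)
  u i = combine i zero
  v i = combine i (suc zero)

  first last : Fin (suc k)
  first = zero
  last  = fromℕ k

  Γ : Graph (suc k * 2)
  Γ = concatMap crossing (allFin k)
      ++ (u first , v first) ∷ (u last , v last) ∷ (u first , u last) ∷ (v first , v last) ∷ []
    where
    crossing : Fin k → List (Fin (suc k * 2) × Fin (suc k * 2))
    crossing i = (u (inject₁ i) , u (suc i)) ∷ (u (inject₁ i) , v (suc i))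
               ∷ (v (inject₁ i) , u (suc i)) ∷ (v (inject₁ i) , v (suc i)) ∷ []

  decompleted : Graph (pred (suc k * 2))
  decompleted = Γ ∖ u first

-- Over 𝔽₂ the value Ψ_G(α) is the parity of the number of spanning trees containing
-- every edge e with α_e = 0, and deletion–contraction computes it one edge at a time.
-- Once the crossings up to u_i, v_i are processed, the later edges only depend on how
-- v_1, u_i, v_i are connected so far: one of the five partitions of a 3-element set.
-- The later edges therefore act through a vector of 𝔽₂⁵, and each crossing changes this
-- vector by one of 16 transfer maps.  Counting the zeros of Ψ_G means summing a function on
-- 𝔽₂⁵, and pulling that function back along a crossing, summed over the transfer maps,
-- turns it into 0 modulo 8 after three crossings; for m = 4, where only two are left after
-- the first edges, the sum over the last two edges does the rest.  So even 8 divides [Ψ_G]₂.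

module Submission where

open import Defs
open import Algebra.Bundles.Raw using (RawSemiring)
open import Data.Bool using (Bool; true; false; not; _∧_; _xor_; if_then_else_) renaming (T to True)
open import Data.Bool.Properties using (∧-assoc; ∧-comm; ∧-zeroʳ; xor-assoc; xor-identityʳ)
open import Data.Empty using (⊥-elim)
open import Data.Fin
  using (Fin; zero; suc; combine; fromℕ; inject₁; join; splitAt; _↑ˡ_; _↑ʳ_)
  renaming (_≟_ to _≟ᶠ_)
open import Data.Fin.Patterns using (0F; 1F; 2F; 3F; 4F)
open import Data.Fin.Properties using (all?; join-splitAt; splitAt-↑ˡ)
open import Data.Fin.Subset using (Subset; inside; outside; _∈_; _∉_; _-_; ⊤; _⊆_)
open import Data.Fin.Subset.Properties
  using (_∈?_; ∈⊤; p─q⊆p; p─⊥≡p; p─x─y≡p─y─x; x∈p∧x≢y⇒x∈p-y)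
open import Data.List as List
  using (List; []; _∷_; _++_; allFin; concatMap; filter; foldr; length; map)
open import Data.List.Properties
  using (concatMap-map; map-++; map-concatMap; map-tabulate; map-∘; mapMaybe-++)
open import Data.Nat using (ℕ; zero; suc; pred; _+_; _*_; _/_; _%_; _≤_; _≟_; s≤s)
open import Data.Nat.Divisibility using (divides; m%n≡0⇒n∣m)
open import Data.Nat.DivMod using (_mod_; %-distribˡ-+; m*n/n≡m; m*n%n≡0)
open import Data.Nat.Properties using (*-assoc; +-commutativeSemigroup; +-identityʳ)
open import Algebra.Properties.CommutativeSemigroup +-commutativeSemigroup using (interchange)
open import Data.Product as Product using (∃; _×_; _,_)
open import Data.Product.Function.NonDependent.Propositional using (_×-⇔_)
open import Data.Sum using (_⊎_; inj₁; inj₂; map₁; swap)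
open import Data.Sum.Function.Propositional using (_⊎-⇔_)
open import Data.Sum.Properties as Sumₚ using (inj₁-injective; inj₂-injective)
  renaming (≡-dec to ⊎-≡-dec)
open import Data.Vec as Vec using (Vec; []; _∷_; fromList; here; lookup; tabulate; there; toList)
  renaming (_++_ to _++ᵛ_)
open import Data.Vec.Properties as Vecₚ using (lookup∘tabulate; tabulate-cong; toList-map)
open import Function using (_∘_; id; _⇔_; mk⇔; Equivalence)
open import Function.Properties.Equivalence using () renaming (sym to ⇔-sym; trans to ⇔-trans)
open import Relation.Binary using (DecidableEquality)
open import Relation.Binary.PropositionalEquality
open import Relation.Nullary using (¬_; Dec; yes; no; does)
open import Relation.Nullary.Decidable
  using (T?; _×-dec_; _⊎-dec_; ¬?; dec-false; does-⇔; from-yes; map′)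
open import Relation.Unary using (Decidable)
open ≡-Reasoning

-- Paths

module _ {n : ℕ} {G : Graph n} {T : EdgeSet G} where

  path-mono : ∀ {A B u v} → A ⊆ B → Path G T A u v → Path G T B u v
  path-mono A⊆B (stop u∈A) = stop (A⊆B u∈A)
  path-mono {A} {B} A⊆B (step {u = u} e w u∈A e∈T j p) =
    step e w (A⊆B u∈A) e∈T j (path-mono minus p)
    where
    minus : A - u ⊆ B - u
    minus {x} x∈ = x∈p∧x≢y⇒x∈p-y (A⊆B (p─q⊆p _ _ x∈)) λ { refl → x∉p-x A x∈ }
      where
      x∉p-x : ∀ {m} {x : Fin m} (p : Subset m) → x ∉ p - x
      x∉p-x {x = zero}  (_ ∷ _) ()
      x∉p-x {x = suc _} (_ ∷ p) (there x∈p) = x∉p-x p x∈p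

  -- Prepending a vertex `u` to a path is only allowed if the path avoids `u`. If it does not, its
  -- tail from `u` onwards already is a path from `u`, so nothing has to be prepended. This is what
  -- makes concatenation and reversal of paths possible.
  avoid-or-restart : ∀ {A w v} u → Path G T A w v → Path G T (A - u) w v ⊎ Path G T A u v
  avoid-or-restart {w = w} u p with w ≟ᶠ u
  ... | yes refl = inj₂ p
  avoid-or-restart u (stop w∈A) | no w≢u = inj₁ (stop (x∈p∧x≢y⇒x∈p-y w∈A w≢u))
  avoid-or-restart {A} {w} u (step e w′ w∈A e∈T j p) | no w≢u with avoid-or-restart u p
  ... | inj₁ q = inj₁ (step e w′ (x∈p∧x≢y⇒x∈p-y w∈A w≢u) e∈T j
                   (subst (λ B → Path G T B w′ _) (p─x─y≡p─y─x A w u) q))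
  ... | inj₂ q = inj₂ (path-mono (p─q⊆p _ _) q)

  path-step : ∀ {e u w v} → e ∈ T → Joins G e u w → Path G T ⊤ w v → Path G T ⊤ u v
  path-step {e} {u} {w} e∈T j p with avoid-or-restart u p
  ... | inj₁ q = step e w ∈⊤ e∈T j q
  ... | inj₂ q = q

  path-trans : ∀ {A u w v} → Path G T A u w → Path G T ⊤ w v → Path G T ⊤ u v
  path-trans (stop _)            q = q
  path-trans (step _ _ _ e∈T j p) q = path-step e∈T j (path-trans p q)

  path-sym : ∀ {A u v} → Path G T A u v → Path G T ⊤ v u
  path-sym (stop _)             = stop ∈⊤
  path-sym (step _ _ _ e∈T j p) = path-trans (path-sym p) (path-step e∈T (swap j) (stop ∈⊤))

-- Spanning trees by contraction

does-sound : ∀ {A : Set} (a? : Dec A) → True (does a?) → A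
does-sound (yes a) _ = a

does-complete : ∀ {A : Set} (a? : Dec A) → A → True (does a?)
does-complete (yes _) _ = _
does-complete (no ¬a) a = ¬a a

-- A contraction of a graph is recorded by a labelling of its vertices: two vertices are
-- identified when their labels agree.
module Labels {L : Set} (_≟_ : DecidableEquality L) {V : Set} where

  Labelling : Set
  Labelling = V → L

  -- The labels of x and y are arguments of replace in order to be evaluated only once;
  -- otherwise evaluating iterated merges takes exponential time.
  merge : Labelling → V → V → Labelling
  merge ρ x y = replace (ρ x) (ρ y) ∘ ρ
    where
    replace : L → L → L → L
    replace a b c = if does (c ≟ a) then b else c

  MergedEq : Labelling → V → V → V → V → Set
  MergedEq ρ x y u v = ρ u ≡ ρ v ⊎ (ρ u ≡ ρ x × ρ v ≡ ρ y) ⊎ (ρ u ≡ ρ y × ρ v ≡ ρ x)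

  merge-≡ : ∀ ρ x y u v → merge ρ x y u ≡ merge ρ x y v ⇔ MergedEq ρ x y u v
  merge-≡ ρ x y u v = mk⇔ to from
    where
    to : merge ρ x y u ≡ merge ρ x y v → MergedEq ρ x y u v
    to eq with ρ u ≟ ρ x | ρ v ≟ ρ x
    ... | yes p | yes q = inj₁ (trans p (sym q))
    ... | yes p | no _  = inj₂ (inj₁ (p , sym eq))
    ... | no _  | yes q = inj₂ (inj₂ (eq , q))
    ... | no _  | no _  = inj₁ eq
    from : MergedEq ρ x y u v → merge ρ x y u ≡ merge ρ x y v
    from h with ρ u ≟ ρ x | ρ v ≟ ρ x
    from h                     | yes p | yes q = refl
    from (inj₁ e)              | yes p | no ¬q = ⊥-elim (¬q (trans (sym e) p))
    from (inj₂ (inj₁ (_ , e))) | yes p | no ¬q = sym e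
    from (inj₂ (inj₂ (_ , e))) | yes p | no ¬q = ⊥-elim (¬q e)
    from (inj₁ e)              | no ¬p | yes q = ⊥-elim (¬p (trans e q))
    from (inj₂ (inj₁ (e , _))) | no ¬p | yes q = ⊥-elim (¬p e)
    from (inj₂ (inj₂ (e , _))) | no ¬p | yes q = e
    from (inj₁ e)              | no ¬p | no ¬q = e
    from (inj₂ (inj₁ (e , _))) | no ¬p | no ¬q = ⊥-elim (¬p e)
    from (inj₂ (inj₂ (_ , e))) | no ¬p | no ¬q = ⊥-elim (¬q e)

  module _ (ρ : Labelling) (x y u v : V) where
    open Equivalence (merge-≡ ρ x y u v) public
      renaming (to to merge-elim; from to merge-intro)

  merge-extend : ∀ ρ x y {u v} → ρ u ≡ ρ v → merge ρ x y u ≡ merge ρ x y v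
  merge-extend ρ x y = merge-intro ρ x y _ _ ∘ inj₁

  merge-join : ∀ ρ x y → merge ρ x y x ≡ merge ρ x y y
  merge-join ρ x y = merge-intro ρ x y x y (inj₂ (inj₁ (refl , refl)))

  -- K judges the labelling that is left when all edges have been processed.
  treeIndicator : ∀ {m} → (Labelling → Bool) → Labelling → Vec (V × V) m → Vec Bool m → Bool
  treeIndicator K ρ []            []          = K ρ
  treeIndicator K ρ (_ ∷ G)       (false ∷ T) = treeIndicator K ρ G T
  treeIndicator K ρ ((x , y) ∷ G) (true ∷ T)  =
    not (does (ρ x ≟ ρ y)) ∧ treeIndicator K (merge ρ x y) G T

constant? : ∀ {n} {L : Set} → DecidableEquality L → (ρ : Fin n → L) → Dec (∀ u v → ρ u ≡ ρ v)
constant? _≟_ ρ = all? λ u → all? λ v → ρ u ≟ ρ v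

module _ {L : Set} (_≟_ : DecidableEquality L) {n : ℕ} where
  open Labels _≟_ {Fin n}

  components : Labelling → (G : Graph n) → EdgeSet G → Labelling
  components ρ []            []            = ρ
  components ρ (_ ∷ G)       (outside ∷ T) = components ρ G T
  components ρ ((x , y) ∷ G) (inside ∷ T)  = components (merge ρ x y) G T

  -- Refinement of partitions. The labels themselves carry no meaning, only which of them coincide.
  infix 4 _≼_
  _≼_ : Labelling → Labelling → Set
  ρ ≼ σ = ∀ u v → ρ u ≡ ρ v → σ u ≡ σ v

  merge-mono : ∀ {ρ σ} x y → ρ ≼ σ → merge ρ x y ≼ merge σ x y
  merge-mono {ρ} {σ} x y ρ≼σ u v eq = merge-intro σ x y u v (weaken (merge-elim ρ x y u v eq))
    where
    weaken : MergedEq ρ x y u v → MergedEq σ x y u v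
    weaken (inj₁ e)                = inj₁ (ρ≼σ u v e)
    weaken (inj₂ (inj₁ (e₁ , e₂))) = inj₂ (inj₁ (ρ≼σ u x e₁ , ρ≼σ v y e₂))
    weaken (inj₂ (inj₂ (e₁ , e₂))) = inj₂ (inj₂ (ρ≼σ u y e₁ , ρ≼σ v x e₂))

  merge-least : ∀ {ρ σ} x y → ρ ≼ σ → σ x ≡ σ y → merge ρ x y ≼ σ
  merge-least {ρ} x y ρ≼σ e u v eq with merge-elim ρ x y u v eq
  ... | inj₁ e₀               = ρ≼σ u v e₀
  ... | inj₂ (inj₁ (e₁ , e₂)) = trans (ρ≼σ u x e₁) (trans e (sym (ρ≼σ v y e₂)))
  ... | inj₂ (inj₂ (e₁ , e₂)) = trans (ρ≼σ u y e₁) (trans (sym e) (sym (ρ≼σ v x e₂)))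

  -- Contractions commute as partitions, although the labels produced in the two orders may differ.
  -- By symmetry one inclusion is enough.
  merge-swap : ∀ ρ x y a b → merge (merge ρ x y) a b ≼ merge (merge ρ a b) x y
  merge-swap ρ x y a b =
    merge-least a b (merge-mono x y λ _ _ → merge-extend ρ a b)
                    (merge-extend (merge ρ a b) x y (merge-join ρ a b))

  components-mono : ∀ {ρ σ} G T → ρ ≼ σ → components ρ G T ≼ components σ G T
  components-mono []            []            ρ≼σ = ρ≼σ
  components-mono (_ ∷ G)       (outside ∷ T) ρ≼σ = components-mono G T ρ≼σ
  components-mono ((x , y) ∷ G) (inside ∷ T)  ρ≼σ = components-mono G T (merge-mono x y ρ≼σ)

  components-extend : ∀ ρ G T → ρ ≼ components ρ G T
  components-extend ρ []            []            u v e = e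
  components-extend ρ (_ ∷ G)       (outside ∷ T) u v e = components-extend ρ G T u v e
  components-extend ρ ((x , y) ∷ G) (inside ∷ T)  u v e =
    components-extend (merge ρ x y) G T u v (merge-extend ρ x y e)

  components-edge : ∀ {ρ} G T {e x y} → e ∈ T → List.lookup G e ≡ (x , y) →
                    components ρ G T x ≡ components ρ G T y
  components-edge {ρ} ((x , y) ∷ G) (inside ∷ T) here refl =
    components-extend (merge ρ x y) G T x y (merge-join ρ x y)
  components-edge (_ ∷ G) (outside ∷ T) (there e∈T) eq = components-edge G T e∈T eq
  components-edge (_ ∷ G) (inside ∷ T)  (there e∈T) eq = components-edge G T e∈T eq

  components-joins : ∀ {ρ} G T {e x y} → e ∈ T → Joins G e x y →
                     components ρ G T x ≡ components ρ G T y
  components-joins G T e∈T (inj₁ eq) = components-edge G T e∈T eq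
  components-joins G T e∈T (inj₂ eq) = sym (components-edge G T e∈T eq)

  components-path : ∀ {ρ} G T {A u v} → Path G T A u v → components ρ G T u ≡ components ρ G T v
  components-path G T (stop _) = refl
  components-path G T (step _ _ _ e∈T j p) =
    trans (components-joins G T e∈T j) (components-path G T p)

  -- Each merge is the least one possible, so `components` gives the smallest equivalence relation
  -- that contains `ρ` and the edges of `T`. With path-connectedness for `R`, equal labels yield a
  -- path.
  components-least : ∀ (R : Fin n → Fin n → Set) →
    (∀ {u v} → R u v → R v u) → (∀ {u v w} → R u v → R v w → R u w) →
    ∀ {ρ} G T → (∀ {u v} → ρ u ≡ ρ v → R u v) →
    (∀ {e x y} → e ∈ T → List.lookup G e ≡ (x , y) → R x y) →
    ∀ {u v} → components ρ G T u ≡ components ρ G T v → R u v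
  components-least R R-sym R-trans [] [] base edge = base
  components-least R R-sym R-trans (_ ∷ G) (outside ∷ T) base edge =
    components-least R R-sym R-trans G T base (edge ∘ there)
  components-least R R-sym R-trans {ρ} ((x , y) ∷ G) (inside ∷ T) base edge =
    components-least R R-sym R-trans G T base′ (edge ∘ there)
    where
    base′ : ∀ {u v} → merge ρ x y u ≡ merge ρ x y v → R u v
    base′ {u} {v} eq with merge-elim ρ x y u v eq
    ... | inj₁ e                = base e
    ... | inj₂ (inj₁ (e₁ , e₂)) = R-trans (base e₁) (R-trans (edge here refl) (R-sym (base e₂)))
    ... | inj₂ (inj₂ (e₁ , e₂)) =
      R-trans (base e₁) (R-trans (R-sym (edge here refl)) (R-sym (base e₂)))

  components⇒path : ∀ {ρ} → (∀ {u v} → ρ u ≡ ρ v → u ≡ v) → ∀ G T {u v} →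
                    components ρ G T u ≡ components ρ G T v → Path G T ⊤ u v
  components⇒path inj G T = components-least (Path G T ⊤) path-sym path-trans G T
    (λ e → subst (Path G T ⊤ _) (inj e) (stop ∈⊤))
    (λ e∈T eq → path-step e∈T (inj₁ eq) (stop ∈⊤))

  -- A cycle through `e` shows as the ends of `e` staying connected without `e`. Working relative to
  -- a contraction `ρ` lets an induction on the edge list move the head edge into `ρ`.
  Acyclic : Labelling → (G : Graph n) → EdgeSet G → Set
  Acyclic ρ G T = ∀ {e x y} → e ∈ T → List.lookup G e ≡ (x , y) →
                  components ρ G (T - e) x ≢ components ρ G (T - e) y

  acyclic-anti : ∀ {ρ σ} G T → ρ ≼ σ → Acyclic σ G T → Acyclic ρ G T
  acyclic-anti G T ρ≼σ acyc e∈T eq = acyc e∈T eq ∘ components-mono G _ ρ≼σ _ _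

  acyclic-head : ∀ {ρ} x y G T → Acyclic ρ ((x , y) ∷ G) (inside ∷ T) →
                 components ρ G T x ≢ components ρ G T y
  acyclic-head {ρ} x y G T acyc eq =
    -- Removing the head edge from `inside ∷ T` computes to `outside ∷ (T ─ ⊥)`, which still has to
    -- be identified with `outside ∷ T`.
    acyc here refl (subst (λ S → components ρ G S x ≡ components ρ G S y) (sym (p─⊥≡p T)) eq)

  acyclic-tail : ∀ {ρ} x y G T → Acyclic ρ ((x , y) ∷ G) (inside ∷ T) → Acyclic (merge ρ x y) G T
  acyclic-tail x y G T acyc e∈T = acyc (there e∈T)

  -- The exchange property: if x and y became connected, the edge of T that
  -- connected them would close a cycle once x and y are merged.
  acyclic-separates : ∀ {ρ} x y G T → Acyclic (merge ρ x y) G T →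
                      components ρ G T x ≡ components ρ G T y → ρ x ≡ ρ y
  acyclic-separates x y [] [] acyc eq = eq
  acyclic-separates x y (_ ∷ G) (outside ∷ T) acyc eq =
    acyclic-separates x y G T (λ e∈T → acyc (there e∈T)) eq
  acyclic-separates {ρ} x y ((a , b) ∷ G) (inside ∷ T) acyc eq
    with merge-elim ρ a b x y (acyclic-separates x y G T
           -- The induction hypothesis is used at `merge ρ a b`, so the two merges must change
           -- places.
           (acyclic-anti G T (merge-swap ρ a b x y) (acyclic-tail a b G T acyc)) eq)
  ... | inj₁ e = e
  ... | inj₂ (inj₁ (e₁ , e₂)) = ⊥-elim (acyclic-head a b G T acyc
          (components-extend _ G T a b (merge-intro ρ x y a b (inj₂ (inj₁ (sym e₁ , sym e₂))))))
  ... | inj₂ (inj₂ (e₁ , e₂)) = ⊥-elim (acyclic-head a b G T acyc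
          (components-extend _ G T a b (merge-intro ρ x y a b (inj₂ (inj₂ (sym e₂ , sym e₁))))))

  acyclic-cons : ∀ {ρ} x y G T → ρ x ≢ ρ y → Acyclic (merge ρ x y) G T →
                 Acyclic ρ ((x , y) ∷ G) (inside ∷ T)
  acyclic-cons {ρ} x y G T x≢y acyc here refl eq = x≢y (acyclic-separates x y G T acyc
    (subst (λ S → components ρ G S x ≡ components ρ G S y) (p─⊥≡p T) eq))
  acyclic-cons x y G T x≢y acyc (there e∈T) eq = acyc e∈T eq

  constantᵇ : Labelling → Bool
  constantᵇ ρ = does (constant? _≟_ ρ)

  treeIndicator-sound : ∀ {ρ} G T → True (treeIndicator constantᵇ ρ (fromList G) T) →
    Acyclic ρ G T × (∀ u v → components ρ G T u ≡ components ρ G T v)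
  treeIndicator-sound {ρ} [] [] t = (λ { () }) , does-sound (constant? _≟_ ρ) t
  treeIndicator-sound (_ ∷ G) (outside ∷ T) t with treeIndicator-sound G T t
  ... | acyc , c = (λ { (there e∈T) → acyc e∈T }) , c
  treeIndicator-sound {ρ} ((x , y) ∷ G) (inside ∷ T) t
    with no x≢y ← ρ x ≟ ρ y with treeIndicator-sound G T t
  ... | acyc , c = acyclic-cons x y G T x≢y acyc , c

  treeIndicator-complete : ∀ {ρ} G T → Acyclic ρ G T →
    (∀ u v → components ρ G T u ≡ components ρ G T v) →
    True (treeIndicator constantᵇ ρ (fromList G) T)
  treeIndicator-complete {ρ} [] [] acyc c = does-complete (constant? _≟_ ρ) c
  treeIndicator-complete (_ ∷ G) (outside ∷ T) acyc c =
    treeIndicator-complete G T (λ e∈T → acyc (there e∈T)) c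
  treeIndicator-complete {ρ} ((x , y) ∷ G) (inside ∷ T) acyc c with ρ x ≟ ρ y
  ... | yes e = acyclic-head x y G T acyc (components-extend ρ G T x y e)
  ... | no _  = treeIndicator-complete G T (acyclic-tail x y G T acyc) c

  -- An injective `ρ` means that nothing is contracted yet. The label type stays arbitrary because
  -- the ladder is later started from `extend m id`, whose labels form a disjoint sum.
  isSpanningTree-treeIndicator : ∀ {ρ} → (∀ {u v} → ρ u ≡ ρ v → u ≡ v) → ∀ G T →
    does (isSpanningTree? G T) ≡ treeIndicator constantᵇ ρ (fromList G) T
  isSpanningTree-treeIndicator {ρ} inj G T =
    does-⇔ (mk⇔ complete sound) (isSpanningTree? G T) (T? _)
    where
    complete : IsSpanningTree G T → True (treeIndicator constantᵇ ρ (fromList G) T)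
    complete (conn , acyc) = treeIndicator-complete G T
      (λ e∈T eq c → acyc (_ , _ , _ , e∈T , inj₂ eq , components⇒path inj G _ c))
      (λ u v → components-path G T (conn u v))
    sound : True (treeIndicator constantᵇ ρ (fromList G) T) → IsSpanningTree G T
    sound t with treeIndicator-sound G T t
    ... | acyc , c = (λ u v → components⇒path inj G T (c u v)) , λ
      { (_ , _ , _ , e∈T , inj₁ eq , p) → acyc e∈T eq (sym (components-path G _ p))
      ; (_ , _ , _ , e∈T , inj₂ eq , p) → acyc e∈T eq (components-path G _ p) }

-- The Kirchhoff polynomial over 𝔽₂

bit : Bool → Fin 2
bit false = zero
bit true  = suc zero

isOne : Fin 2 → Bool
isOne zero    = false
isOne (suc _) = true

open RawSemiring (𝔽 2) using () renaming (_+_ to _⊕_; _*_ to _⊗_; 1# to 1₂)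

bit-xor : ∀ a b → bit a ⊕ bit b ≡ bit (a xor b)
bit-xor false false = refl
bit-xor false true  = refl
bit-xor true  false = refl
bit-xor true  true  = refl

⊗-bit : ∀ x b → x ⊗ bit b ≡ bit (isOne x ∧ b)
⊗-bit zero       false = refl
⊗-bit zero       true  = refl
⊗-bit (suc zero) false = refl
⊗-bit (suc zero) true  = refl

module _ {A : Set} where

  xorSum : List A → (A → Bool) → Bool
  xorSum xs f = foldr (λ x → f x xor_) false xs

  xorSum-cong : ∀ xs {f g : A → Bool} → f ≗ g → xorSum xs f ≡ xorSum xs g
  xorSum-cong []       f≗g = refl
  xorSum-cong (x ∷ xs) f≗g = cong₂ _xor_ (f≗g x) (xorSum-cong xs f≗g)

  xorSum-∧ : ∀ xs a (f : A → Bool) → xorSum xs (λ x → a ∧ f x) ≡ a ∧ xorSum xs f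
  xorSum-∧ xs       true  f = refl
  xorSum-∧ []       false f = refl
  xorSum-∧ (_ ∷ xs) false f = xorSum-∧ xs false f

  foldr-⊕-filter : ∀ {P : A → Set} (P? : Decidable P) (h : A → Bool) {q : A → Bool}
    {w : A → Fin 2} → (∀ x → does (P? x) ≡ q x) → (∀ x → w x ≡ bit (h x)) → ∀ xs →
    foldr _⊕_ (0 mod 2) (map w (filter P? xs)) ≡ bit (xorSum xs (λ x → q x ∧ h x))
  foldr-⊕-filter P? h q≡ w≡ [] = refl
  foldr-⊕-filter P? h {q} q≡ w≡ (x ∷ xs) with does (P? x) | q≡ x
  ... | false | eq rewrite sym eq = foldr-⊕-filter P? h q≡ w≡ xs
  ... | true  | eq rewrite sym eq =
    trans (cong₂ _⊕_ (w≡ x) (foldr-⊕-filter P? h q≡ w≡ xs)) (bit-xor (h x) _)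

xorSum-++-map : ∀ {A B : Set} (g : B → A) ys xs f →
                xorSum (map g ys ++ xs) f ≡ xorSum ys (f ∘ g) xor xorSum xs f
xorSum-++-map g []       xs f = refl
xorSum-++-map g (y ∷ ys) xs f =
  trans (cong (f (g y) xor_) (xorSum-++-map g ys xs f)) (sym (xor-assoc (f (g y)) _ _))

subsets : ∀ m → List (Vec Bool m)
subsets = tuples (outside ∷ inside ∷ [])

xorSum-subsets : ∀ m (f : Vec Bool (suc m) → Bool) →
  xorSum (subsets (suc m)) f ≡
  xorSum (subsets m) (f ∘ (false ∷_)) xor xorSum (subsets m) (f ∘ (true ∷_))
xorSum-subsets m f = begin
  xorSum (map (false ∷_) (subsets m) ++ map (true ∷_) (subsets m) ++ []) f
    ≡⟨ xorSum-++-map (false ∷_) (subsets m) _ f ⟩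
  xorSum (subsets m) (f ∘ (false ∷_)) xor xorSum (map (true ∷_) (subsets m) ++ []) f
    ≡⟨ cong (xorSum (subsets m) (f ∘ (false ∷_)) xor_)
         (trans (xorSum-++-map (true ∷_) (subsets m) [] f) (xor-identityʳ _)) ⟩
  xorSum (subsets m) (f ∘ (false ∷_)) xor xorSum (subsets m) (f ∘ (true ∷_)) ∎

-- The value over 𝔽₂ of the monomial of `T`: it is 1 exactly when every edge outside `T` has the
-- value 1.
covers : ∀ {m} → Vec (Fin 2) m → Vec Bool m → Bool
covers []      []          = true
covers (a ∷ α) (false ∷ T) = isOne a ∧ covers α T
covers (_ ∷ α) (true ∷ T)  = covers α T

does-∈? : ∀ {m} (e : Fin m) (T : Subset m) → does (e ∈? T) ≡ lookup T e
does-∈? zero    (inside ∷ T)  = refl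
does-∈? zero    (outside ∷ T) = refl
does-∈? (suc e) (_ ∷ T)       = does-∈? e T

foldr-⊗-filter : ∀ {A : Set} {P : A → Set} (P? : Decidable P) (w : A → Fin 2) →
  ∀ {m} (f : Fin m → A) (α : Vec (Fin 2) m) (T : Vec Bool m) →
  (∀ e → w (f e) ≡ lookup α e) → (∀ e → does (P? (f e)) ≡ not (lookup T e)) →
  foldr _⊗_ 1₂ (map w (filter P? (List.tabulate f))) ≡ bit (covers α T)
foldr-⊗-filter P? w f []      []      w≡ P≡ = refl
foldr-⊗-filter P? w f (a ∷ α) (s ∷ T) w≡ P≡
  with ih ← foldr-⊗-filter P? w (f ∘ suc) α T (w≡ ∘ suc) (P≡ ∘ suc)
  with does (P? (f zero)) | s | P≡ zero
... | false | true  | _ = ih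
... | true  | false | _ = trans (cong₂ _⊗_ (w≡ zero) ih) (⊗-bit a (covers α T))

module Parity {L : Set} (_≟_ : DecidableEquality L) {V : Set} where
  open Labels _≟_ {V}

  -- Deletion-contraction: α_e times the value of G minus e, plus the value of G contracted along e,
  -- where the second term vanishes if e has become a loop. Disconnectedness is only detected by `K`
  -- at the end.
  parity : ∀ {m} → (Labelling → Bool) → Labelling → Vec (V × V) m → Vec (Fin 2) m → Bool
  parity K ρ []            []      = K ρ
  parity K ρ ((x , y) ∷ G) (a ∷ α) =
    (isOne a ∧ parity K ρ G α) xor (not (does (ρ x ≟ ρ y)) ∧ parity K (merge ρ x y) G α)

  parity-xorSum : ∀ {m} K ρ (G : Vec (V × V) m) α →
    xorSum (subsets m) (λ T → treeIndicator K ρ G T ∧ covers α T) ≡ parity K ρ G α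
  parity-xorSum K ρ [] [] with K ρ
  ... | false = refl
  ... | true  = refl
  parity-xorSum {suc m} K ρ ((x , y) ∷ G) (a ∷ α) = begin
    xorSum (subsets (suc m)) summand
      ≡⟨ xorSum-subsets m summand ⟩
    xorSum (subsets m) (λ T → treeIndicator K ρ G T ∧ (isOne a ∧ covers α T)) xor
    xorSum (subsets m) (λ T → (unjoined ∧ treeIndicator K (merge ρ x y) G T) ∧ covers α T)
      ≡⟨ cong₂ _xor_ (xorSum-cong (subsets m) λ T → ∧-shift (treeIndicator K ρ G T) (isOne a) _)
                     (xorSum-cong (subsets m) λ T → ∧-assoc unjoined _ _) ⟩
    xorSum (subsets m) (λ T → isOne a ∧ (treeIndicator K ρ G T ∧ covers α T)) xor
    xorSum (subsets m) (λ T → unjoined ∧ (treeIndicator K (merge ρ x y) G T ∧ covers α T))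
      ≡⟨ cong₂ _xor_ (xorSum-∧ (subsets m) (isOne a) _) (xorSum-∧ (subsets m) unjoined _) ⟩
    (isOne a ∧ xorSum (subsets m) (λ T → treeIndicator K ρ G T ∧ covers α T)) xor
    (unjoined ∧ xorSum (subsets m) (λ T → treeIndicator K (merge ρ x y) G T ∧ covers α T))
      ≡⟨ cong₂ (λ p q → (isOne a ∧ p) xor (unjoined ∧ q))
           (parity-xorSum K ρ G α) (parity-xorSum K (merge ρ x y) G α) ⟩
    parity K ρ ((x , y) ∷ G) (a ∷ α) ∎
    where
    summand : Vec Bool (suc m) → Bool
    summand T = treeIndicator K ρ ((x , y) ∷ G) T ∧ covers (a ∷ α) T
    unjoined : Bool
    unjoined = not (does (ρ x ≟ ρ y))
    ∧-shift : ∀ p q r → p ∧ (q ∧ r) ≡ q ∧ (p ∧ r)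
    ∧-shift p q r = trans (sym (∧-assoc p q r)) (trans (cong (_∧ r) (∧-comm p q)) (∧-assoc q p r))

module _ {L : Set} (_≟_ : DecidableEquality L) {n : ℕ} {ρ : Fin n → L}
         (ρ-inj : ∀ {u v} → ρ u ≡ ρ v → u ≡ v) where
  open Parity _≟_ {Fin n}

  Ψ-parity : ∀ (G : Graph n) α → Ψ (𝔽 2) G α ≡ bit (parity (constantᵇ _≟_) ρ (fromList G) α)
  Ψ-parity G α = trans
    (foldr-⊕-filter (isSpanningTree? G) (covers α)
       (isSpanningTree-treeIndicator _≟_ ρ-inj G)
       (λ T → foldr-⊗-filter (λ e → ¬? (e ∈? T)) (lookup α) id α T (λ _ → refl)
                (λ e → cong not (does-∈? e T)))
       (subsets (length G)))
    (cong bit (parity-xorSum (constantᵇ _≟_) ρ (fromList G) α))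

-- Counting zeros over 𝔽₂

-- The first coordinate is the innermost summation, so that a sum over a concatenation
-- unfolds to a sum over its tail.
Σ₂ : ∀ m → (Vec (Fin 2) m → ℕ) → ℕ
Σ₂ zero    f = f []
Σ₂ (suc m) f = Σ₂ m λ α → f (zero ∷ α) + f (suc zero ∷ α)

Σ₂-cong : ∀ m {f g} → f ≗ g → Σ₂ m f ≡ Σ₂ m g
Σ₂-cong zero    f≗g = f≗g []
Σ₂-cong (suc m) f≗g = Σ₂-cong m λ α → cong₂ _+_ (f≗g _) (f≗g _)

isZero : Bool → ℕ
isZero b = if b then 0 else 1

countZeros : ∀ {A : Set} → (A → Fin 2) → List A → ℕ
countZeros f xs = length (filter (λ α → f α ≟ᶠ 0 mod 2) xs)

Σ₂-+ : ∀ m f g → Σ₂ m f + Σ₂ m g ≡ Σ₂ m (λ α → f α + g α)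
Σ₂-+ zero    f g = refl
Σ₂-+ (suc m) f g = trans (Σ₂-+ m _ _)
  (Σ₂-cong m λ α → interchange (f (zero ∷ α)) (f (suc zero ∷ α)) (g (zero ∷ α)) (g (suc zero ∷ α)))

countZeros-++-map : ∀ {A B : Set} (g : B → A) (f : A → Fin 2) ys xs →
  countZeros f (map g ys ++ xs) ≡ countZeros (f ∘ g) ys + countZeros f xs
countZeros-++-map g f []       xs = refl
countZeros-++-map g f (y ∷ ys) xs with does (f (g y) ≟ᶠ 0 mod 2)
... | false = countZeros-++-map g f ys xs
... | true  = cong suc (countZeros-++-map g f ys xs)

countZeros-tuples : ∀ m {f : Vec (Fin 2) m → Fin 2} {h : Vec (Fin 2) m → Bool} →
  (∀ α → f α ≡ bit (h α)) → countZeros f (tuples (allFin 2) m) ≡ Σ₂ m (isZero ∘ h)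
countZeros-tuples zero {f} {h} f≡ with f [] | h [] | f≡ []
... | _ | false | refl = refl
... | _ | true  | refl = refl
countZeros-tuples (suc m) {f} {h} f≡ = begin
  countZeros f (tuples (allFin 2) (suc m))
    ≡⟨ countZeros-++-map (zero ∷_) f ts _ ⟩
  countZeros (f ∘ (zero ∷_)) ts + countZeros f (map (suc zero ∷_) ts ++ [])
    ≡⟨ cong (countZeros (f ∘ (zero ∷_)) ts +_)
         (trans (countZeros-++-map (suc zero ∷_) f ts []) (+-identityʳ _)) ⟩
  countZeros (f ∘ (zero ∷_)) ts + countZeros (f ∘ (suc zero ∷_)) ts
    ≡⟨ cong₂ _+_ (countZeros-tuples m (f≡ ∘ (zero ∷_))) (countZeros-tuples m (f≡ ∘ (suc zero ∷_))) ⟩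
  Σ₂ m (isZero ∘ h ∘ (zero ∷_)) + Σ₂ m (isZero ∘ h ∘ (suc zero ∷_))
    ≡⟨ Σ₂-+ m _ _ ⟩
  Σ₂ (suc m) (isZero ∘ h) ∎
  where
  ts : List (Vec (Fin 2) m)
  ts = tuples (allFin 2) m

-- Quotients and extensions of labellings

open Labels using (merge)
open Parity using (parity)

Edges : ℕ → ℕ → Set
Edges n m = Vec (Fin n × Fin n) m

relabel : ∀ {n n′ m} → (Fin n′ → Fin n) → Edges n′ m → Edges n m
relabel f = Vec.map (Product.map f f)

-- The two labellings induce the same partition of A.
infix 4 _∼_
_∼_ : ∀ {A B C : Set} → (A → B) → (A → C) → Set
l ∼ l′ = ∀ i j → l i ≡ l j ⇔ l′ i ≡ l′ j

∼-via : ∀ {A B C : Set} {l : A → B} {l′ : A → C} (g : B → C) (h : C → B) →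
        l′ ≗ g ∘ l → l ≗ h ∘ l′ → l ∼ l′
∼-via g h l′≗ l≗ i j = mk⇔ (λ e → trans (l′≗ i) (trans (cong g e) (sym (l′≗ j))))
                           (λ e → trans (l≗ i) (trans (cong h e) (sym (l≗ j))))

∼-reflexive : ∀ {A B : Set} {l l′ : A → B} → l ≗ l′ → l ∼ l′
∼-reflexive l≗l′ = ∼-via id id (sym ∘ l≗l′) l≗l′

module _ {L L′ : Set} (_≟_ : DecidableEquality L) (_≟′_ : DecidableEquality L′) where

  constantᵇ-quotient : ∀ {n n′} (f : Fin n′ → Fin n) ρ ρ′ → ρ ∘ f ∼ ρ′ →
    (∀ z → ∃ λ i → ρ z ≡ ρ (f i)) → constantᵇ _≟_ ρ ≡ constantᵇ _≟′_ ρ′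
  constantᵇ-quotient f ρ ρ′ ker onto = does-⇔
    (mk⇔ (λ c i j → Equivalence.to (ker i j) (c (f i) (f j))) from)
    (constant? _≟_ ρ) (constant? _≟′_ ρ′)
    where
    from : (∀ i j → ρ′ i ≡ ρ′ j) → ∀ u v → ρ u ≡ ρ v
    from c u v with onto u | onto v
    ... | i , eᵢ | j , eⱼ = trans eᵢ (trans (Equivalence.from (ker i j) (c i j)) (sym eⱼ))

  merge-∼ : ∀ {V V′ : Set} (f : V′ → V) ρ ρ′ x y → ρ ∘ f ∼ ρ′ →
            merge _≟_ ρ (f x) (f y) ∘ f ∼ merge _≟′_ ρ′ x y
  merge-∼ f ρ ρ′ x y ker i j =
    ⇔-trans (Labels.merge-≡ _≟_ ρ (f x) (f y) (f i) (f j))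
    (⇔-trans (ker i j ⊎-⇔ ((ker i x ×-⇔ ker j y) ⊎-⇔ (ker i y ×-⇔ ker j x)))
             (⇔-sym (Labels.merge-≡ _≟′_ ρ′ x y i j)))

  -- The edges touch only the image of `f`, and every class meets that image, so the vertices
  -- outside it carry no information. Both hypotheses survive a merge, since classes only grow.
  parity-quotient : ∀ {n n′ m} (f : Fin n′ → Fin n) ρ ρ′ → ρ ∘ f ∼ ρ′ →
    (∀ z → ∃ λ i → ρ z ≡ ρ (f i)) → ∀ (G : Edges n′ m) α →
    parity _≟_ (constantᵇ _≟_) ρ (relabel f G) α ≡ parity _≟′_ (constantᵇ _≟′_) ρ′ G α
  parity-quotient f ρ ρ′ ker onto [] [] = constantᵇ-quotient f ρ ρ′ ker onto
  parity-quotient f ρ ρ′ ker onto ((x , y) ∷ G) (a ∷ α) = cong₂ _xor_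
    (cong (isOne a ∧_) (parity-quotient f ρ ρ′ ker onto G α))
    (cong₂ (λ p q → not p ∧ q)
      (does-⇔ (ker x y) (ρ (f x) ≟ ρ (f y)) (ρ′ x ≟′ ρ′ y))
      (parity-quotient f _ _ (merge-∼ f ρ ρ′ x y ker)
        (λ z → Product.map₂ (Labels.merge-extend _≟_ ρ (f x) (f y)) (onto z)) G α))

  parity-∼ : ∀ {n m} (ρ : Fin n → L) (ρ′ : Fin n → L′) → ρ ∼ ρ′ → ∀ (G : Edges n m) α →
    parity _≟_ (constantᵇ _≟_) ρ G α ≡ parity _≟′_ (constantᵇ _≟′_) ρ′ G α
  parity-∼ ρ ρ′ ker G α =
    trans (cong (λ H → parity _≟_ (constantᵇ _≟_) ρ H α) (sym (Vecₚ.map-id G)))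
          (parity-quotient id ρ ρ′ ker (λ z → z , refl) G α)

module _ {L : Set} (_≟_ : DecidableEquality L) where

  -- No edge touches the class of `z`, so it never merges with the image of `f` and the final
  -- labelling cannot be constant. The successor in `suc n′` provides a vertex `f zero` to compare
  -- with `z`.
  parity-isolated : ∀ {n n′ m} (f : Fin (suc n′) → Fin n) ρ z → (∀ i → ρ (f i) ≢ ρ z) →
    ∀ (G : Edges (suc n′) m) α → parity _≟_ (constantᵇ _≟_) ρ (relabel f G) α ≡ false
  parity-isolated f ρ z iso [] [] = dec-false (constant? _≟_ ρ) λ c → iso zero (c (f zero) z)
  parity-isolated f ρ z iso ((x , y) ∷ G) (a ∷ α) = cong₂ _xor_
    (trans (cong (isOne a ∧_) (parity-isolated f ρ z iso G α)) (∧-zeroʳ (isOne a)))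
    (trans (cong (_ ∧_) (parity-isolated f (merge _≟_ ρ (f x) (f y)) z iso′ G α)) (∧-zeroʳ _))
    where
    iso′ : ∀ i → merge _≟_ ρ (f x) (f y) (f i) ≢ merge _≟_ ρ (f x) (f y) z
    iso′ i eq with Labels.merge-elim _≟_ ρ (f x) (f y) (f i) z eq
    ... | inj₁ e              = iso i e
    ... | inj₂ (inj₁ (_ , e)) = iso y (sym e)
    ... | inj₂ (inj₂ (_ , e)) = iso x (sym e)

  parity-cong : ∀ {V : Set} {m} {K K′ : (V → L) → Bool} → K ≗ K′ → ∀ ρ (G : Vec (V × V) m) α →
    parity _≟_ K ρ G α ≡ parity _≟_ K′ ρ G α
  parity-cong K≗ ρ []            []      = K≗ ρ
  parity-cong K≗ ρ ((x , y) ∷ G) (a ∷ α) = cong₂ _xor_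
    (cong (isOne a ∧_) (parity-cong K≗ ρ G α))
    (cong (not (does (ρ x ≟ ρ y)) ∧_) (parity-cong K≗ (merge _≟_ ρ x y) G α))

-- The last m vertices are still isolated.
extend : ∀ {b} {C : Set} m → (Fin b → C) → Fin (b + m) → C ⊎ Fin m
extend {b} m l z = map₁ l (splitAt b z)

module _ {C : Set} (_≟_ : DecidableEquality C) where

  infix 4 _≟⁺_
  _≟⁺_ : ∀ {m} → DecidableEquality (C ⊎ Fin m)
  _≟⁺_ = ⊎-≡-dec _≟_ _≟ᶠ_

  treeParity : ∀ {b m p} → (Fin b → C) → Edges (b + m) p → Vec (Fin 2) p → Bool
  treeParity {b} {m} l = parity _≟⁺_ (constantᵇ _≟⁺_) (extend m l)

  merge-extended : ∀ {b m} (l : Fin b → C) i j (z : Fin (b + m)) →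
    merge _≟⁺_ (extend m l) (i ↑ˡ m) (j ↑ˡ m) z ≡ extend m (merge _≟_ l i j) z
  merge-extended {b} {m} l i j z
    rewrite splitAt-↑ˡ b i m | splitAt-↑ˡ b j m with splitAt b z
  ... | inj₂ _ = refl
  ... | inj₁ c with l c ≟ l i
  ...   | yes _ = refl
  ...   | no _  = refl

  -- The edges of `H` touch only the first `b` vertices, so they can be processed on the labelling
  -- of these alone. All of `G` then enters as the function that judges the resulting labelling.
  parity-extend : ∀ {b m p q} (H : Edges b p) (G : Edges (b + m) q) l α β →
    treeParity l (relabel (_↑ˡ m) H ++ᵛ G) (α ++ᵛ β) ≡
    parity _≟_ (λ l′ → treeParity l′ G β) l H α
  parity-extend [] G l [] β = refl
  parity-extend {b} {m} ((x , y) ∷ H) G l (a ∷ α) β = cong₂ _xor_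
    (cong (isOne a ∧_) (parity-extend H G l α β))
    (cong₂ (λ p q → not p ∧ q) same
      (trans (parity-∼ _≟⁺_ _≟⁺_ _ _ (∼-reflexive (merge-extended l x y))
               (relabel (_↑ˡ m) H ++ᵛ G) (α ++ᵛ β))
             (parity-extend H G (merge _≟_ l x y) α β)))
    where
    same : does (extend m l (x ↑ˡ m) ≟⁺ extend m l (y ↑ˡ m)) ≡ does (l x ≟ l y)
    same rewrite splitAt-↑ˡ b x m | splitAt-↑ˡ b y m with l x ≟ l y
    ... | yes _ = refl
    ... | no _  = refl

  extend-∼ : ∀ {b m} {D : Set} {l : Fin b → C} {l′ : Fin b → D} → l ∼ l′ → extend m l ∼ extend m l′
  extend-∼ {b} {l = l} {l′} ker i j with splitAt b i | splitAt b j
  ... | inj₁ c | inj₁ d = mk⇔ (cong inj₁ ∘ Equivalence.to (ker c d) ∘ inj₁-injective)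
                              (cong inj₁ ∘ Equivalence.from (ker c d) ∘ inj₁-injective)
  ... | inj₁ _ | inj₂ _ = mk⇔ (λ ()) (λ ())
  ... | inj₂ _ | inj₁ _ = mk⇔ (λ ()) (λ ())
  ... | inj₂ _ | inj₂ _ = mk⇔ (cong inj₂ ∘ inj₂-injective) (cong inj₂ ∘ inj₂-injective)

-- The transfer map of the ladder

-- In order: all separate, then only {0, 1}, only {0, 2}, only {1, 2} joined, then all joined. This
-- order also fixes the coordinates of every vector in 𝔽₂⁵ below.
partition : Fin 5 → Fin 3 → Fin 3
partition s i = lookup (lookup partitions s) i
  where
  partitions : Vec (Vec (Fin 3) 3) 5
  partitions = (0F ∷ 1F ∷ 2F ∷ []) ∷ (0F ∷ 0F ∷ 2F ∷ []) ∷ (0F ∷ 1F ∷ 0F ∷ [])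
             ∷ (0F ∷ 1F ∷ 1F ∷ []) ∷ (0F ∷ 0F ∷ 0F ∷ []) ∷ []

∼-triple : ∀ {A B : Set} {l : Fin 3 → A} {l′ : Fin 3 → B} →
  (l 0F ≡ l 1F ⇔ l′ 0F ≡ l′ 1F) → (l 0F ≡ l 2F ⇔ l′ 0F ≡ l′ 2F) →
  (l 1F ≡ l 2F ⇔ l′ 1F ≡ l′ 2F) → l ∼ l′
∼-triple {l = l} {l′} e₀₁ e₀₂ e₁₂ = table
  where
  flip : ∀ {i j} → (l i ≡ l j ⇔ l′ i ≡ l′ j) → (l j ≡ l i ⇔ l′ j ≡ l′ i)
  flip e = mk⇔ (sym ∘ Equivalence.to e ∘ sym) (sym ∘ Equivalence.from e ∘ sym)
  diagonal : ∀ {i} → l i ≡ l i ⇔ l′ i ≡ l′ i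
  diagonal = mk⇔ (λ _ → refl) (λ _ → refl)
  table : l ∼ l′
  table 0F 0F = diagonal
  table 0F 1F = e₀₁
  table 0F 2F = e₀₂
  table 1F 0F = flip e₀₁
  table 1F 1F = diagonal
  table 1F 2F = e₁₂
  table 2F 0F = flip e₀₂
  table 2F 1F = flip e₁₂
  table 2F 2F = diagonal

module _ {C : Set} (_≟_ : DecidableEquality C) where

  classify : (Fin 3 → C) → Fin 5
  classify l with l 0F ≟ l 1F | l 0F ≟ l 2F | l 1F ≟ l 2F
  ... | yes _ | yes _ | _     = 4F
  ... | yes _ | no _  | _     = 1F
  ... | no _  | yes _ | _     = 2F
  ... | no _  | no _  | yes _ = 3F
  ... | no _  | no _  | no _  = 0F

  classify-∼ : ∀ l → l ∼ partition (classify l)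
  classify-∼ l with l 0F ≟ l 1F | l 0F ≟ l 2F | l 1F ≟ l 2F
  ... | yes p | yes q | _     = ∼-triple (joined p refl) (joined q refl) (joined (trans (sym p) q) refl)
    where
    joined : ∀ {A B : Set} {x y : A} {x′ y′ : B} → x ≡ y → x′ ≡ y′ → x ≡ y ⇔ x′ ≡ y′
    joined p q = mk⇔ (λ _ → q) (λ _ → p)
  ... | yes p | no ¬q | _     = ∼-triple (mk⇔ (λ _ → refl) (λ _ → p))
    (mk⇔ (⊥-elim ∘ ¬q) λ ()) (mk⇔ (λ e → ⊥-elim (¬q (trans p e))) λ ())
  ... | no ¬p | yes q | _     = ∼-triple (mk⇔ (⊥-elim ∘ ¬p) λ ())
    (mk⇔ (λ _ → refl) (λ _ → q)) (mk⇔ (λ e → ⊥-elim (¬p (trans q (sym e)))) λ ())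
  ... | no ¬p | no ¬q | yes r = ∼-triple (mk⇔ (⊥-elim ∘ ¬p) λ ())
    (mk⇔ (⊥-elim ∘ ¬q) λ ()) (mk⇔ (λ _ → refl) (λ _ → r))
  ... | no ¬p | no ¬q | no ¬r = ∼-triple (mk⇔ (⊥-elim ∘ ¬p) λ ())
    (mk⇔ (⊥-elim ∘ ¬q) λ ()) (mk⇔ (⊥-elim ∘ ¬r) λ ())

-- Passing a crossing forgets the old rung, the vertices 1 and 2.
skip : ∀ {m} → Fin (3 + m) → Fin (5 + m)
skip zero    = zero
skip (suc i) = suc (suc (suc i))

-- The crossing between the rungs {1, 2} and {3, 4}.
crossing₅ : Edges 5 4
crossing₅ = (1F , 3F) ∷ (1F , 4F) ∷ (2F , 3F) ∷ (2F , 4F) ∷ []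

-- The edges still to come when j crossings are left: 0 is v_1, and 1, 2 are the current
-- u_i, v_i.
ladder : ∀ j → Edges (3 + j * 2) (j * 4 + 2)
ladder zero    = (1F , 2F) ∷ (0F , 2F) ∷ []
ladder (suc j) = relabel (_↑ˡ (j * 2)) crossing₅ ++ᵛ relabel skip (ladder j)

-- What the deletion of u_1 leaves of the first crossing: v_1 u_2 and v_1 v_2.
start : Edges 3 2
start = (0F , 1F) ∷ (0F , 2F) ∷ []

-- The vector of 𝔽₂⁵ through which the remaining edges act, with one coordinate for each partition
-- of the boundary.
states : ∀ j → Vec (Fin 2) (j * 4 + 2) → Vec Bool 5
states j α = tabulate λ s → treeParity _≟ᶠ_ (partition s) (ladder j) α

treeParity-∼ : ∀ {b m p} {C D : Set} (_≟_ : DecidableEquality C) (_≟′_ : DecidableEquality D)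
  {l : Fin b → C} {l′ : Fin b → D} → l ∼ l′ → ∀ (G : Edges (b + m) p) α →
  treeParity _≟_ l G α ≡ treeParity _≟′_ l′ G α
treeParity-∼ _≟_ _≟′_ ker = parity-∼ _ _ _ _ (extend-∼ _≟_ ker)

module _ {C : Set} (_≟_ : DecidableEquality C) where

  treeParity-states : ∀ j (l : Fin 3 → C) α →
    treeParity _≟_ l (ladder j) α ≡ lookup (states j α) (classify _≟_ l)
  treeParity-states j l α = trans
    (treeParity-∼ _≟_ _≟ᶠ_ (classify-∼ _≟_ l) (ladder j) α)
    (sym (lookup∘tabulate (λ s → treeParity _≟ᶠ_ (partition s) (ladder j) α) (classify _≟_ l)))

  -- A component of forgotten vertices only can never be connected to the rest.
  Kept : (Fin 5 → C) → C → Set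
  Kept l c = c ≡ l 0F ⊎ c ≡ l 3F ⊎ c ≡ l 4F

  kept? : ∀ l c → Dec (Kept l c)
  kept? l c = (c ≟ l 0F) ⊎-dec (c ≟ l 3F) ⊎-dec (c ≟ l 4F)

  -- Judges the labelling after a crossing: the value is 0 if an old rung vertex has lost contact
  -- with v_1 and the new rung, and otherwise the coordinate of `w` for the partition of the new
  -- boundary.
  forget : Vec Bool 5 → (Fin 5 → C) → Bool
  forget w l =
    does (kept? l (l 1F)) ∧ (does (kept? l (l 2F)) ∧ lookup w (classify _≟_ (l ∘ skip)))

  extend-skip : ∀ {m} (l : Fin 5 → C) → extend m l ∘ skip ≗ extend m (l ∘ skip)
  extend-skip l 0F                  = refl
  extend-skip l 1F                  = refl
  extend-skip l 2F                  = refl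
  extend-skip l (suc (suc (suc i))) = refl

  isolated : ∀ {m} l {c} → ¬ Kept l c → ∀ i → extend m l (skip i) ≢ inj₁ c
  isolated l ¬k 0F eq = ¬k (inj₁ (sym (inj₁-injective eq)))
  isolated l ¬k 1F eq = ¬k (inj₂ (inj₁ (sym (inj₁-injective eq))))
  isolated l ¬k 2F eq = ¬k (inj₂ (inj₂ (sym (inj₁-injective eq))))
  isolated l ¬k (suc (suc (suc i))) ()

  kept-extend : ∀ {m} l {c} → Kept l c → ∃ λ i → inj₁ c ≡ extend m l (skip i)
  kept-extend l (inj₁ e)        = 0F , cong inj₁ e
  kept-extend l (inj₂ (inj₁ e)) = 1F , cong inj₁ e
  kept-extend l (inj₂ (inj₂ e)) = 2F , cong inj₁ e

  -- An old rung vertex that is cut off makes `parity-isolated` apply. Otherwise both old vertices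
  -- lie in classes of the new boundary, and `parity-quotient` discards them.
  treeParity-skip : ∀ j l α (k₁? : Dec (Kept l (l 1F))) (k₂? : Dec (Kept l (l 2F))) →
    treeParity _≟_ l (relabel skip (ladder j)) α ≡
    does k₁? ∧ (does k₂? ∧ lookup (states j α) (classify _≟_ (l ∘ skip)))
  treeParity-skip j l α (no ¬k) _ = parity-isolated _ skip _ 1F (isolated l ¬k) (ladder j) α
  treeParity-skip j l α (yes _) (no ¬k) = parity-isolated _ skip _ 2F (isolated l ¬k) (ladder j) α
  treeParity-skip j l α (yes k₁) (yes k₂) = trans
    (parity-quotient _ (_≟⁺_ _≟_) skip _ (extend (j * 2) (l ∘ skip))
      (∼-reflexive (extend-skip l)) onto (ladder j) α)
    (treeParity-states j (l ∘ skip) α)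
    where
    onto : ∀ z → ∃ λ i → extend (j * 2) l z ≡ extend (j * 2) l (skip i)
    onto 0F                              = 0F , refl
    onto 1F                              = kept-extend l k₁
    onto 2F                              = kept-extend l k₂
    onto 3F                              = 1F , refl
    onto 4F                              = 2F , refl
    onto (suc (suc (suc (suc (suc z))))) = suc (suc (suc z)) , refl

-- The next rung, isolated so far, joins the boundary. Only the bracketing of the disjoint sum of
-- labels changes.
extend-extend : ∀ {m} {C : Set} (l : Fin 3 → C) → extend (2 + m) l ∼ extend m (extend 2 l)
extend-extend {m} {C} l = ∼-via split unsplit split-extend unsplit-extend
  where
  split : C ⊎ Fin (2 + m) → (C ⊎ Fin 2) ⊎ Fin m
  split (inj₁ c)             = inj₁ (inj₁ c)
  split (inj₂ 0F)            = inj₁ (inj₂ 0F)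
  split (inj₂ 1F)            = inj₁ (inj₂ 1F)
  split (inj₂ (suc (suc i))) = inj₂ i
  unsplit : (C ⊎ Fin 2) ⊎ Fin m → C ⊎ Fin (2 + m)
  unsplit (inj₁ (inj₁ c))  = inj₁ c
  unsplit (inj₁ (inj₂ i))  = inj₂ (i ↑ˡ m)
  unsplit (inj₂ i)         = inj₂ (suc (suc i))
  split-extend : extend m (extend 2 l) ≗ split ∘ extend (2 + m) l
  split-extend 0F                              = refl
  split-extend 1F                              = refl
  split-extend 2F                              = refl
  split-extend 3F                              = refl
  split-extend 4F                              = refl
  split-extend (suc (suc (suc (suc (suc i))))) = refl
  unsplit-extend : extend (2 + m) l ≗ unsplit ∘ extend m (extend 2 l)
  unsplit-extend 0F                              = refl
  unsplit-extend 1F                              = refl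
  unsplit-extend 2F                              = refl
  unsplit-extend 3F                              = refl
  unsplit-extend 4F                              = refl
  unsplit-extend (suc (suc (suc (suc (suc i))))) = refl

_≟⁵_ : DecidableEquality (Fin 3 ⊎ Fin 2)
_≟⁵_ = ⊎-≡-dec _≟ᶠ_ _≟ᶠ_

initial : Vec (Fin 2) 2 → Vec Bool 5 → Bool
initial α w = parity _≟ᶠ_ (λ l → lookup w (classify _≟ᶠ_ l)) id start α

transfer : Vec (Fin 2) 4 → Vec Bool 5 → Vec Bool 5
transfer α w = tabulate λ s → parity _≟⁵_ (forget _≟⁵_ w) (extend 2 (partition s)) crossing₅ α

-- Three moves: take the next rung into the boundary, split off the crossing, forget the old rung.
states-suc : ∀ j α β → states (suc j) (α ++ᵛ β) ≡ transfer α (states j β)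
states-suc j α β = tabulate-cong λ s → begin
  treeParity _≟ᶠ_ (partition s) (ladder (suc j)) (α ++ᵛ β)
    ≡⟨ parity-∼ _ _ _ _ (extend-extend (partition s)) (ladder (suc j)) (α ++ᵛ β) ⟩
  treeParity _≟⁵_ (extend 2 (partition s)) (ladder (suc j)) (α ++ᵛ β)
    ≡⟨ parity-extend _≟⁵_ crossing₅ (relabel skip (ladder j)) (extend 2 (partition s)) α β ⟩
  parity _≟⁵_ (λ l → treeParity _≟⁵_ l (relabel skip (ladder j)) β) (extend 2 (partition s)) crossing₅ α
    ≡⟨ parity-cong _≟⁵_ (λ l → treeParity-skip _≟⁵_ j l β (kept? _≟⁵_ l _) (kept? _≟⁵_ l _)) _ crossing₅ α ⟩
  parity _≟⁵_ (forget _≟⁵_ (states j β)) (extend 2 (partition s)) crossing₅ α ∎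

-- Here `j` is m - 2: of the m - 1 crossings, the first is reduced to `start`.
graph : ∀ j → Edges (3 + j * 2) (2 + (j * 4 + 2))
graph j = relabel (_↑ˡ (j * 2)) start ++ᵛ ladder j

-- The edge list of the decompleted ladder

module _ (k : ℕ) where
  open CappedXLadder k using (u; v)

  crossing : Fin k → List (Fin (suc k * 2) × Fin (suc k * 2))
  crossing i = (u (inject₁ i) , u (suc i)) ∷ (u (inject₁ i) , v (suc i))
             ∷ (v (inject₁ i) , u (suc i)) ∷ (v (inject₁ i) , v (suc i)) ∷ []

  crossings : Graph (suc k * 2)
  crossings = concatMap crossing (allFin k)

shift : ∀ {m n} → (Fin m → Fin n) → Graph m → Graph n
shift f = map (Product.map f f)

crossings-suc : ∀ k → crossings (suc k) ≡
  (0F , 2F) ∷ (0F , 3F) ∷ (1F , 2F) ∷ (1F , 3F) ∷ shift (2 ↑ʳ_) (crossings k)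
crossings-suc k = cong (crossing (suc k) 0F ++_) (begin
  concatMap (crossing (suc k)) (List.tabulate suc)
    ≡⟨ cong (concatMap (crossing (suc k))) (map-tabulate id suc) ⟨
  concatMap (crossing (suc k)) (map suc (allFin k))
    ≡⟨ concatMap-map (crossing (suc k)) suc (allFin k) ⟩
  -- `combine (suc i) r` computes to `2 ↑ʳ combine i r`, so going one rung further is a shift by two
  -- vertices.
  concatMap (shift (2 ↑ʳ_) ∘ crossing k) (allFin k)
    ≡⟨ map-concatMap (Product.map (2 ↑ʳ_) (2 ↑ʳ_)) (crossing k) (allFin k) ⟨
  shift (2 ↑ʳ_) (crossings k) ∎)

∖-zero : ∀ {n} (G : Graph n) → shift suc G ∖ zero ≡ G
∖-zero []      = refl
∖-zero (e ∷ G) = cong (e ∷_) (∖-zero G)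

shift-∘ : ∀ {l m n} (f : Fin m → Fin n) (g : Fin l → Fin m) G → shift f (shift g G) ≡ shift (f ∘ g) G
shift-∘ f g G = sym (map-∘ G)

-- The two cap edges that survive the deletion of u_1, namely u_m v_m and v_1 v_m, where v_1 is now
-- the vertex 0.
ends : ∀ j → Graph (3 + j * 2)
ends j = (suc (combine (fromℕ j) 0F) , suc (combine (fromℕ j) 1F))
       ∷ (0F , suc (combine (fromℕ j) 1F)) ∷ []

-- Away from the vertex 0, `skip` is the shift by two vertices that also appears in `crossings-suc`,
-- and it carries `ends j` to `ends (suc j)`.
toList-ladder : ∀ j → toList (ladder j) ≡ shift suc (crossings j) ++ ends j
toList-ladder zero    = refl
toList-ladder (suc j) = begin
  toList (ladder (suc j))
    ≡⟨ cong (four ++_) (toList-map _ (ladder j)) ⟩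
  four ++ shift skip (toList (ladder j))
    ≡⟨ cong (λ G → four ++ shift skip G) (toList-ladder j) ⟩
  four ++ shift skip (shift suc (crossings j) ++ ends j)
    ≡⟨ cong (four ++_) (map-++ _ (shift suc (crossings j)) (ends j)) ⟩
  four ++ shift skip (shift suc (crossings j)) ++ ends (suc j)
    ≡⟨ cong (λ G → four ++ G ++ ends (suc j))
         (trans (shift-∘ skip suc (crossings j)) (sym (shift-∘ suc (2 ↑ʳ_) (crossings j)))) ⟩
  four ++ shift suc (shift (2 ↑ʳ_) (crossings j)) ++ ends (suc j)
    ≡⟨ cong (λ G → shift suc G ++ ends (suc j)) (crossings-suc j) ⟨
  shift suc (crossings (suc j)) ++ ends (suc j) ∎
  where
  four : Graph (5 + j * 2)
  four = (1F , 3F) ∷ (1F , 4F) ∷ (2F , 3F) ∷ (2F , 4F) ∷ []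

∖-++ : ∀ {n} (G H : Graph (suc n)) x → (G ++ H) ∖ x ≡ (G ∖ x) ++ (H ∖ x)
∖-++ G H x = mapMaybe-++ _ G H

decompleted-graph : ∀ j → CappedXLadder.decompleted (suc j) ≡ toList (graph j)
decompleted-graph j = begin
  (crossings (suc j) ++ caps) ∖ zero
    ≡⟨ cong (λ G → (G ++ caps) ∖ zero) (crossings-suc j) ⟩
  (0F , 1F) ∷ (0F , 2F) ∷ ((shift (2 ↑ʳ_) (crossings j) ++ caps) ∖ zero)
    ≡⟨ cong front (∖-++ (shift (2 ↑ʳ_) (crossings j)) caps zero) ⟩
  front ((shift (2 ↑ʳ_) (crossings j) ∖ zero) ++ ends j)
    ≡⟨ cong (λ G → front (G ∖ zero ++ ends j)) (shift-∘ suc suc (crossings j)) ⟨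
  front ((shift suc (shift suc (crossings j)) ∖ zero) ++ ends j)
    ≡⟨ cong (λ G → front (G ++ ends j)) (∖-zero (shift suc (crossings j))) ⟩
  front (shift suc (crossings j) ++ ends j)
    ≡⟨ cong front (toList-ladder j) ⟨
  toList (graph j) ∎
  where
  open CappedXLadder (suc j) using (u; v; first; last)
  caps : Graph (suc (suc j) * 2)
  caps = (u first , v first) ∷ (u last , v last) ∷ (u first , u last) ∷ (v first , v last) ∷ []
  front : Graph (3 + j * 2) → Graph (3 + j * 2)
  front G = (0F , 1F) ∷ (0F , 2F) ∷ G

-- Counting modulo 8

Σ₂-++ : ∀ p q f → Σ₂ (p + q) f ≡ Σ₂ q (λ β → Σ₂ p (λ α → f (α ++ᵛ β)))
Σ₂-++ zero    q f = refl
Σ₂-++ (suc p) q f = Σ₂-++ p q λ γ → f (zero ∷ γ) + f (suc zero ∷ γ)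

infix 4 _≡₈_
_≡₈_ : ℕ → ℕ → Set
a ≡₈ b = a % 8 ≡ b % 8

+-cong₈ : ∀ {a a′ b b′} → a ≡₈ a′ → b ≡₈ b′ → a + b ≡₈ a′ + b′
+-cong₈ {a} {a′} {b} {b′} a≡ b≡ =
  trans (%-distribˡ-+ a b 8) (trans (cong₂ (λ x y → (x + y) % 8) a≡ b≡) (sym (%-distribˡ-+ a′ b′ 8)))

Σ₂-cong₈ : ∀ m {f g} → (∀ α → f α ≡₈ g α) → Σ₂ m f ≡₈ Σ₂ m g
Σ₂-cong₈ zero            f≡g = f≡g []
Σ₂-cong₈ (suc m) {f} {g} f≡g =
  Σ₂-cong₈ m λ α → +-cong₈ {f (zero ∷ α)} {g (zero ∷ α)} (f≡g (zero ∷ α)) (f≡g (suc zero ∷ α))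

all-bits? : ∀ n {P : Vec Bool n → Set} → (∀ w → Dec (P w)) → Dec (∀ w → P w)
all-bits? zero    P? = map′ (λ { p [] → p }) (λ p → p []) (P? [])
all-bits? (suc n) P? = map′
  (λ { (p , q) (false ∷ w) → p w ; (p , q) (true ∷ w) → q w })
  (λ p → (λ w → p (false ∷ w)) , (λ w → p (true ∷ w)))
  (all-bits? n (P? ∘ (false ∷_)) ×-dec all-bits? n (P? ∘ (true ∷_)))

pullback : (Vec Bool 5 → ℕ) → Vec Bool 5 → ℕ
pullback g w = Σ₂ 4 λ α → g (transfer α w)

total : (Vec Bool 5 → ℕ) → ℕ → ℕ
total g j = Σ₂ (j * 4 + 2) (g ∘ states j)

total-suc : ∀ g j → total g (suc j) ≡ total (pullback g) j
total-suc g j = trans (Σ₂-++ 4 (j * 4 + 2) (g ∘ states (suc j)))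
  (Σ₂-cong (j * 4 + 2) λ β → Σ₂-cong 4 λ α → cong g (states-suc j α β))

-- g₁ and g₂ are the reductions modulo 8 of the iterated pullbacks of g₀, found by computer.
g₀ g₁ g₂ : Vec Bool 5 → ℕ
g₀ w = Σ₂ 2 λ α → isZero (initial α w)
g₁ (a ∷ b ∷ c ∷ d ∷ e ∷ []) =
  (if b xor c xor d then 2 else 0) + (if a ∧ (b xor c xor d xor e) then 4 else 0)
g₂ (_ ∷ b ∷ c ∷ d ∷ _ ∷ []) = if b xor c xor d then 4 else 0

-- Decided by evaluation at all 32 vectors, with 16 transfer maps for each; the next two congruences
-- are decided in the same way.
pullback-g₀ : ∀ w → pullback g₀ w ≡₈ g₁ w
pullback-g₀ = from-yes (all-bits? 5 λ w → pullback g₀ w % 8 ≟ g₁ w % 8)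

pullback-g₁ : ∀ w → pullback g₁ w ≡₈ g₂ w
pullback-g₁ = from-yes (all-bits? 5 λ w → pullback g₁ w % 8 ≟ g₂ w % 8)

pullback-g₂ : ∀ w → pullback g₂ w ≡₈ 0
pullback-g₂ = from-yes (all-bits? 5 λ w → pullback g₂ w % 8 ≟ 0)

total-cong₈ : ∀ g h → (∀ w → g w ≡₈ h w) → ∀ j → total g j ≡₈ total h j
total-cong₈ g h g≡h j = Σ₂-cong₈ (j * 4 + 2) (g≡h ∘ states j)

total-step : ∀ g h → (∀ w → pullback g w ≡₈ h w) → ∀ j → total g (suc j) ≡₈ total h j
total-step g h g≡h j = trans (cong (_% 8) (total-suc g j)) (total-cong₈ (pullback g) h g≡h j)

total-0 : ∀ j → total (λ _ → 0) j ≡ 0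
total-0 j = Σ₂-zero (j * 4 + 2)
  where
  Σ₂-zero : ∀ m → Σ₂ m (λ _ → 0) ≡ 0
  Σ₂-zero zero    = refl
  Σ₂-zero (suc m) = Σ₂-zero m

total-g₂ : ∀ j → total g₂ j ≡₈ 0
-- The case m = 4: no crossing is left, and the sum over the four values of the last two edges is
-- evaluated.
total-g₂ zero    = refl
total-g₂ (suc j) = trans (total-step g₂ (λ _ → 0) pullback-g₂ j) (cong (_% 8) (total-0 j))

total-g₀ : ∀ j → total g₀ (suc (suc j)) ≡₈ 0
total-g₀ j = trans (total-step g₀ g₁ pullback-g₀ (suc j))
  (trans (total-step g₁ g₂ pullback-g₁ j) (total-g₂ j))

-- From the transfer computation to the zero count and c₂

extend-id-injective : ∀ {b} m {x y} → extend {b} m id x ≡ extend m id y → x ≡ y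
extend-id-injective {b} m {x} {y} eq = begin
  x                        ≡⟨ join-extend x ⟨
  join b m (extend m id x) ≡⟨ cong (join b m) eq ⟩
  join b m (extend m id y) ≡⟨ join-extend y ⟩
  y                        ∎
  where
  join-extend : ∀ z → join b m (extend m id z) ≡ z
  join-extend z = trans (cong (join b m) (Sumₚ.map-id (splitAt b z))) (join-splitAt b m z)

-- Stated for dependent pairs because `length (toList xs)` agrees with `m` only propositionally.
fromList∘toList : ∀ {A : Set} {m} (xs : Vec A m) →
  _≡_ {A = ∃ (Vec A)} (length (toList xs) , fromList (toList xs)) (m , xs)
fromList∘toList []       = refl
fromList∘toList (x ∷ xs) = cong (λ (m , ys) → suc m , x ∷ ys) (fromList∘toList xs)

zeroCount-parity : ∀ {L : Set} (_≟_ : DecidableEquality L) {n m} {ρ : Fin n → L} →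
  (∀ {u v} → ρ u ≡ ρ v → u ≡ v) → ∀ (G : Edges n m) →
  zeroCount 2 (toList G) ≡ Σ₂ m (isZero ∘ parity _≟_ (constantᵇ _≟_) ρ G)
zeroCount-parity _≟_ {ρ = ρ} ρ-inj G = trans
  (countZeros-tuples (length (toList G)) (Ψ-parity _≟_ ρ-inj (toList G)))
  (cong (λ (m , H) → Σ₂ m (isZero ∘ parity _≟_ (constantᵇ _≟_) ρ H)) (fromList∘toList G))

zeroCount-extend : ∀ {b m p q} (H : Edges b p) (G : Edges (b + m) q) →
  zeroCount 2 (toList (relabel (_↑ˡ m) H ++ᵛ G)) ≡
  Σ₂ q (λ β → Σ₂ p λ α → isZero (parity _≟ᶠ_ (λ l → treeParity _≟ᶠ_ l G β) id H α))
zeroCount-extend {b} {m} {p} {q} H G = begin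
  zeroCount 2 (toList (relabel (_↑ˡ m) H ++ᵛ G))
    ≡⟨ zeroCount-parity (_≟⁺_ _≟ᶠ_) (extend-id-injective m) (relabel (_↑ˡ m) H ++ᵛ G) ⟩
  Σ₂ (p + q) zeros
    ≡⟨ Σ₂-++ p q zeros ⟩
  Σ₂ q (λ β → Σ₂ p λ α → zeros (α ++ᵛ β))
    ≡⟨ Σ₂-cong q (λ β → Σ₂-cong p λ α → cong isZero (parity-extend _≟ᶠ_ H G id α β)) ⟩
  Σ₂ q (λ β → Σ₂ p λ α → isZero (parity _≟ᶠ_ (λ l → treeParity _≟ᶠ_ l G β) id H α)) ∎
  where
  zeros : Vec (Fin 2) (p + q) → ℕ
  zeros = isZero ∘ treeParity _≟ᶠ_ {b} {m} id (relabel (_↑ˡ m) H ++ᵛ G)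

zeroCount-graph : ∀ j → zeroCount 2 (toList (graph j)) ≡ total g₀ j
zeroCount-graph j = trans (zeroCount-extend start (ladder j))
  (Σ₂-cong (j * 4 + 2) λ β → Σ₂-cong 2 λ α → cong isZero
    (parity-cong _≟ᶠ_ (λ l → treeParity-states _≟ᶠ_ j l β) id start α))

-- A record, so that conversion checking compares the graphs instead of evaluating their
-- zero counts.
record ZeroCount≡₈0 {n} (G : Graph n) : Set where
  constructor zeroCount≡₈0
  field residue : zeroCount 2 G ≡₈ 0

graph-zeroCount : ∀ j → ZeroCount≡₈0 (toList (graph (suc (suc j))))
graph-zeroCount j = zeroCount≡₈0 (trans (cong (_% 8) (zeroCount-graph (suc (suc j)))) (total-g₀ j))

c₂-zero : ∀ {n} {G : Graph n} → ZeroCount≡₈0 G → c₂ 2 G ≡ 0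
c₂-zero {G = G} (zeroCount≡₈0 count≡0) with divides q eq ← m%n≡0⇒n∣m (zeroCount 2 G) 8 count≡0 = begin
  -- The count is 8q = 2q · 4, so its quotient by 2² is the even number 2q.
  zeroCount 2 G / 4 % 2 ≡⟨ cong (λ n → n / 4 % 2) (trans eq (sym (*-assoc q 2 4))) ⟩
  q * 2 * 4 / 4 % 2     ≡⟨ cong (_% 2) (m*n/n≡m (q * 2) 4) ⟩
  q * 2 % 2             ≡⟨ m*n%n≡0 q 2 ⟩
  0                     ∎

proposition4p1 : (k : ℕ) → 4 ≤ suc k → c₂ 2 (CappedXLadder.decompleted k) ≡ 0
proposition4p1 (suc (suc (suc j))) (s≤s (s≤s (s≤s (s≤s _)))) =
  c₂-zero {pred (suc (suc (suc (suc j))) * 2)} {CappedXLadder.decompleted (suc (suc (suc j)))}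
    -- Here k = j + 3 and m = j + 4, so `j + 2` crossings follow the first one: two of them turn
    -- `g₀` into `g₂`, and `total-g₂` treats the other `j`.
    (subst ZeroCount≡₈0 (sym (decompleted-graph (suc (suc j)))) (graph-zeroCount j))
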